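{- Every non-increasing, non-negative supermodular set function $f:2^{[n]}\to\mathbb{R}_+$ is weakly-$\alpha$-supermodular with parameter $\alpha=1$.
   Context: $[n]=\{1,\dots,n\}$ and $\mathbb{R}_+$ is the set of non-negative reals. A set function $f:2^{[n]}\to\mathbb{R}_+$ is non-increasing if $f(S\cup T)\le f(S)$ for all $S,T\subseteq[n]$. It is supermodular if $f(S\cap T)+f(S\cup T)\ge f(S)+f(T)$ for all $S,T\subseteq[n]$. A non-negative non-increasing set function $f$ is weakly-$\alpha$-supermodular, where $\alpha\ge 1$, if for all $S,T\subseteq[n]$ $$f(S)-f(S\cup T)\le \alpha\cdot|T\setminus S|\cdot\max_{i\in T\setminus S}[f(S)-f(S\cup\{i\})],$$ where the right-hand side is read as $0$ when $T\setminus S=\emptyset$. -}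

module Defs where

open import Data.Fin.Base using (Fin)
open import Data.Fin.Subset using (Subset; _∪_; _∩_; _─_; ⁅_⁆; ∣_∣)
open import Data.Fin.Subset.Properties using (_∈?_)
open import Data.Integer.Base using (+_)
open import Data.List.Base using (List; []; _∷_; map; filter; allFin)
open import Data.List.NonEmpty.Base as List⁺ using (foldr₁)
open import Data.Nat.Base as ℕ using (ℕ)
import Data.Nat.Properties as ℕ
open import Data.Product.Base using (∃; _×_; _,_; proj₁; proj₂)
open import Data.Rational.Base as ℚ using (ℚ; 0ℚ; 1ℚ; ½)
import Data.Rational.Properties as ℚ
import Data.Rational.Solver as ℚSolver
open import Data.Sum.Base using (inj₁; inj₂)
open import Relation.Binary.PropositionalEquality

open ℚSolver.+-*-Solver using (solve; con; _:+_; _:*_; _:-_; :-_; _:=_)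

------------------------------------------------------------------------
-- Real numbers as Cauchy sequences of rationals.
--
-- The setoid equality of two reals, x ≤ y and y ≤ x, is not needed below.

Cauchy : (ℕ → ℚ) → Set
Cauchy x = ∀ ε → 0ℚ ℚ.< ε →
  ∃ λ N → ∀ m n → N ℕ.≤ m → N ℕ.≤ n → ℚ.∣ x m ℚ.- x n ∣ ℚ.≤ ε

record ℝ : Set where
  constructor mkℝ
  field
    seq    : ℕ → ℚ
    cauchy : Cauchy seq

open ℝ public

infix 4 _≤_

_≤_ : ℝ → ℝ → Set
x ≤ y = ∀ ε → 0ℚ ℚ.< ε →
  ∃ λ N → ∀ n → N ℕ.≤ n → seq x n ℚ.≤ seq y n ℚ.+ ε

module CauchyProperties where
  p≤∣p∣ : ∀ p → p ℚ.≤ ℚ.∣ p ∣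
  p≤∣p∣ p with ℚ.≤-total 0ℚ p
  ... | inj₁ 0≤p = ℚ.≤-reflexive (sym (ℚ.0≤p⇒∣p∣≡p 0≤p))
  ... | inj₂ p≤0 = ℚ.≤-trans p≤0 (ℚ.0≤∣p∣ p)

  ∣p∣≤ : ∀ {p r} → p ℚ.≤ r → ℚ.- p ℚ.≤ r → ℚ.∣ p ∣ ℚ.≤ r
  ∣p∣≤ {p} p≤r -p≤r with ℚ.∣p∣≡p∨∣p∣≡-p p
  ... | inj₁ eq = subst (ℚ._≤ _) (sym eq) p≤r
  ... | inj₂ eq = subst (ℚ._≤ _) (sym eq) -p≤r

  ∣p-q∣-sym : ∀ p q → ℚ.∣ p ℚ.- q ∣ ≡ ℚ.∣ q ℚ.- p ∣
  ∣p-q∣-sym p q = trans (sym (ℚ.∣-p∣≡∣p∣ (p ℚ.- q)))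
    (cong ℚ.∣_∣ (solve 2 (λ p q → :- (p :- q) := q :- p) refl p q))

  -- p ≤ q + ε from ∣ p - q ∣ ≤ ε
  near : ∀ {p q ε} → ℚ.∣ p ℚ.- q ∣ ℚ.≤ ε → p ℚ.≤ q ℚ.+ ε
  near {p} {q} {ε} h = begin
    p                        ≡⟨ solve 2 (λ p q → p := q :+ (p :- q)) refl p q ⟩
    q ℚ.+ (p ℚ.- q)          ≤⟨ ℚ.+-monoʳ-≤ q (p≤∣p∣ (p ℚ.- q)) ⟩
    q ℚ.+ ℚ.∣ p ℚ.- q ∣      ≤⟨ ℚ.+-monoʳ-≤ q h ⟩
    q ℚ.+ ε                  ∎
    where open ℚ.≤-Reasoning

  near⁻¹ : ∀ {p q ε} → p ℚ.≤ q ℚ.+ ε → q ℚ.≤ p ℚ.+ ε → ℚ.∣ p ℚ.- q ∣ ℚ.≤ ε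
  near⁻¹ {p} {q} {ε} h k = ∣p∣≤ (move p q h)
    (subst (ℚ._≤ ε) (solve 2 (λ p q → q :- p := :- (p :- q)) refl p q) (move q p k))
    where
    move : ∀ a b → a ℚ.≤ b ℚ.+ ε → a ℚ.- b ℚ.≤ ε
    move a b l = subst (a ℚ.- b ℚ.≤_)
      (solve 2 (λ b e → (b :+ e) :- b := e) refl b ε) (ℚ.+-monoˡ-≤ (ℚ.- b) l)

  half-pos : ∀ {ε} → 0ℚ ℚ.< ε → 0ℚ ℚ.< ε ℚ.* ½
  half-pos {ε} 0<ε = ℚ.positive⁻¹ (ε ℚ.* ½) {{ℚ.pos*pos⇒pos ε {{ℚ.positive 0<ε}} ½}}

  half+half : ∀ ε → ε ℚ.* ½ ℚ.+ ε ℚ.* ½ ≡ ε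
  half+half ε = trans (sym (ℚ.*-distribˡ-+ ε ½ ½)) (ℚ.*-identityʳ ε)

  lub : ∀ {a b} c d {ε} → a ℚ.≤ c ℚ.+ ε → b ℚ.≤ d ℚ.+ ε → a ℚ.⊔ b ℚ.≤ (c ℚ.⊔ d) ℚ.+ ε
  lub c d {ε} h k = ℚ.⊔-lub
    (ℚ.≤-trans h (ℚ.+-monoˡ-≤ ε (ℚ.p≤p⊔q c d)))
    (ℚ.≤-trans k (ℚ.+-monoˡ-≤ ε (ℚ.p≤q⊔p c d)))

  *-mono-≤ : ∀ {p q r s} → 0ℚ ℚ.≤ p → 0ℚ ℚ.≤ s → p ℚ.≤ q → r ℚ.≤ s → p ℚ.* r ℚ.≤ q ℚ.* s
  *-mono-≤ {p} {q} {r} {s} 0≤p 0≤s p≤q r≤s = ℚ.≤-trans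
    (ℚ.*-monoˡ-≤-nonNeg p {{ℚ.nonNegative 0≤p}} r≤s)
    (ℚ.*-monoʳ-≤-nonNeg s {{ℚ.nonNegative 0≤s}} p≤q)

  const-cauchy : ∀ q → Cauchy (λ _ → q)
  const-cauchy q ε 0<ε = 0 , λ _ _ _ _ →
    subst (ℚ._≤ ε) (sym (cong ℚ.∣_∣ (ℚ.+-inverseʳ q))) (ℚ.<⇒≤ 0<ε)

  +-cauchy : ∀ {x y} → Cauchy x → Cauchy y → Cauchy (λ n → x n ℚ.+ y n)
  +-cauchy {x} {y} cx cy ε 0<ε with cx (ε ℚ.* ½) (half-pos 0<ε) | cy (ε ℚ.* ½) (half-pos 0<ε)
  ... | M , hx | N , hy = M ℕ.⊔ N , λ m n m≥ n≥ → begin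
    ℚ.∣ (x m ℚ.+ y m) ℚ.- (x n ℚ.+ y n) ∣
      ≡⟨ cong ℚ.∣_∣ (solve 4 (λ a b c d → (a :+ b) :- (c :+ d) := (a :- c) :+ (b :- d))
           refl (x m) (y m) (x n) (y n)) ⟩
    ℚ.∣ (x m ℚ.- x n) ℚ.+ (y m ℚ.- y n) ∣
      ≤⟨ ℚ.∣p+q∣≤∣p∣+∣q∣ (x m ℚ.- x n) (y m ℚ.- y n) ⟩
    ℚ.∣ x m ℚ.- x n ∣ ℚ.+ ℚ.∣ y m ℚ.- y n ∣
      ≤⟨ ℚ.+-mono-≤
           (hx m n (ℕ.m⊔n≤o⇒m≤o M N m≥) (ℕ.m⊔n≤o⇒m≤o M N n≥))
           (hy m n (ℕ.m⊔n≤o⇒n≤o M N m≥) (ℕ.m⊔n≤o⇒n≤o M N n≥)) ⟩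
    ε ℚ.* ½ ℚ.+ ε ℚ.* ½
      ≡⟨ half+half ε ⟩
    ε ∎
    where open ℚ.≤-Reasoning

  neg-cauchy : ∀ {x} → Cauchy x → Cauchy (λ n → ℚ.- x n)
  neg-cauchy {x} cx ε 0<ε with cx ε 0<ε
  ... | N , h = N , λ m n m≥ n≥ → subst (ℚ._≤ ε)
    (cong ℚ.∣_∣ (solve 2 (λ a b → b :- a := (:- a) :- (:- b)) refl (x m) (x n)))
    (h n m n≥ m≥)

  ⊔-cauchy : ∀ {x y} → Cauchy x → Cauchy y → Cauchy (λ n → x n ℚ.⊔ y n)
  ⊔-cauchy {x} {y} cx cy ε 0<ε with cx ε 0<ε | cy ε 0<ε
  ... | M , hx | N , hy = M ℕ.⊔ N , λ m n m≥ n≥ →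
    near⁻¹ (step m n m≥ n≥) (step n m n≥ m≥)
    where
    step : ∀ m n → M ℕ.⊔ N ℕ.≤ m → M ℕ.⊔ N ℕ.≤ n →
           x m ℚ.⊔ y m ℚ.≤ (x n ℚ.⊔ y n) ℚ.+ ε
    step m n m≥ n≥ = lub (x n) (y n)
      (near {x m} {x n} (hx m n (ℕ.m⊔n≤o⇒m≤o M N m≥) (ℕ.m⊔n≤o⇒m≤o M N n≥)))
      (near {y m} {y n} (hy m n (ℕ.m⊔n≤o⇒n≤o M N m≥) (ℕ.m⊔n≤o⇒n≤o M N n≥)))

  eventuallyBounded : ∀ {x} → Cauchy x →
    ∃ λ B → ∃ λ N → ∀ n → N ℕ.≤ n → ℚ.∣ x n ∣ ℚ.≤ ℚ.∣ B ∣ ℚ.+ 1ℚ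
  eventuallyBounded {x} cx with cx 1ℚ (ℚ.positive⁻¹ 1ℚ)
  ... | N , h = x N , N , λ n n≥ → begin
    ℚ.∣ x n ∣
      ≡⟨ cong ℚ.∣_∣ (solve 2 (λ a b → a := b :+ (a :- b)) refl (x n) (x N)) ⟩
    ℚ.∣ x N ℚ.+ (x n ℚ.- x N) ∣
      ≤⟨ ℚ.∣p+q∣≤∣p∣+∣q∣ (x N) (x n ℚ.- x N) ⟩
    ℚ.∣ x N ∣ ℚ.+ ℚ.∣ x n ℚ.- x N ∣
      ≤⟨ ℚ.+-monoʳ-≤ ℚ.∣ x N ∣ (h n N n≥ ℕ.≤-refl) ⟩
    ℚ.∣ x N ∣ ℚ.+ 1ℚ ∎
    where open ℚ.≤-Reasoning

  divide : ∀ K → ℚ.Positive K → ∀ ε → 0ℚ ℚ.< ε → ∃ λ δ → 0ℚ ℚ.< δ × K ℚ.* δ ≡ ε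
  divide K K>0 ε 0<ε = 1/K ℚ.* ε , 0<δ , Kδ≡ε
    where
    instance
      _ = K>0
      K≢0 : ℚ.NonZero K
      K≢0 = ℚ.pos⇒nonZero K
    1/K : ℚ
    1/K = ℚ.1/ K
    0<δ : 0ℚ ℚ.< 1/K ℚ.* ε
    0<δ = ℚ.positive⁻¹ (1/K ℚ.* ε)
      {{ℚ.pos*pos⇒pos 1/K {{ℚ.1/pos⇒pos K}} ε {{ℚ.positive 0<ε}}}}
    Kδ≡ε : K ℚ.* (1/K ℚ.* ε) ≡ ε
    Kδ≡ε = trans (sym (ℚ.*-assoc K 1/K ε))
      (trans (cong (ℚ._* ε) (ℚ.*-inverseʳ K)) (ℚ.*-identityˡ ε))

  *-cauchy : ∀ {x y} → Cauchy x → Cauchy y → Cauchy (λ n → x n ℚ.* y n)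
  *-cauchy {x} {y} cx cy ε 0<ε = L , bound
    where
    ex = eventuallyBounded {x} cx
    ey = eventuallyBounded {y} cy
    Bx = ℚ.∣ proj₁ ex ∣ ℚ.+ 1ℚ
    By = ℚ.∣ proj₁ ey ∣ ℚ.+ 1ℚ

    positive : ∀ q → ℚ.Positive (ℚ.∣ q ∣ ℚ.+ 1ℚ)
    positive q = ℚ.nonNeg+pos⇒pos ℚ.∣ q ∣ {{ℚ.∣-∣-nonNeg q}} 1ℚ

    quotient = divide (Bx ℚ.+ By)
      (ℚ.pos+pos⇒pos Bx {{positive (proj₁ ex)}} By {{positive (proj₁ ey)}}) ε 0<ε
    δ    = proj₁ quotient
    0<δ  = proj₁ (proj₂ quotient)

    Kδ≡ε : Bx ℚ.* δ ℚ.+ By ℚ.* δ ≡ ε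
    Kδ≡ε = trans (sym (ℚ.*-distribʳ-+ δ Bx By)) (proj₂ (proj₂ quotient))

    Nx = proj₁ (proj₂ ex)
    Ny = proj₁ (proj₂ ey)
    Mx = proj₁ (cx δ 0<δ)
    My = proj₁ (cy δ 0<δ)
    L  = (Nx ℕ.⊔ Ny) ℕ.⊔ (Mx ℕ.⊔ My)

    bound : ∀ m n → L ℕ.≤ m → L ℕ.≤ n → ℚ.∣ x m ℚ.* y m ℚ.- x n ℚ.* y n ∣ ℚ.≤ ε
    bound m n m≥ n≥ = begin
      ℚ.∣ x m ℚ.* y m ℚ.- x n ℚ.* y n ∣
        ≡⟨ cong ℚ.∣_∣ (solve 4 (λ a b c d →
             a :* b :- c :* d := a :* (b :- d) :+ d :* (a :- c))
             refl (x m) (y m) (x n) (y n)) ⟩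
      ℚ.∣ x m ℚ.* (y m ℚ.- y n) ℚ.+ y n ℚ.* (x m ℚ.- x n) ∣
        ≤⟨ ℚ.∣p+q∣≤∣p∣+∣q∣ (x m ℚ.* (y m ℚ.- y n)) (y n ℚ.* (x m ℚ.- x n)) ⟩
      ℚ.∣ x m ℚ.* (y m ℚ.- y n) ∣ ℚ.+ ℚ.∣ y n ℚ.* (x m ℚ.- x n) ∣
        ≡⟨ cong₂ ℚ._+_ (ℚ.∣p*q∣≡∣p∣*∣q∣ (x m) (y m ℚ.- y n))
                       (ℚ.∣p*q∣≡∣p∣*∣q∣ (y n) (x m ℚ.- x n)) ⟩
      ℚ.∣ x m ∣ ℚ.* ℚ.∣ y m ℚ.- y n ∣ ℚ.+ ℚ.∣ y n ∣ ℚ.* ℚ.∣ x m ℚ.- x n ∣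
        ≤⟨ ℚ.+-mono-≤
             (*-mono-≤ (ℚ.0≤∣p∣ (x m)) (ℚ.<⇒≤ 0<δ)
               (proj₂ (proj₂ ex) m (≥Nx m≥)) (proj₂ (cy δ 0<δ) m n (≥My m≥) (≥My n≥)))
             (*-mono-≤ (ℚ.0≤∣p∣ (y n)) (ℚ.<⇒≤ 0<δ)
               (proj₂ (proj₂ ey) n (≥Ny n≥)) (proj₂ (cx δ 0<δ) m n (≥Mx m≥) (≥Mx n≥))) ⟩
      Bx ℚ.* δ ℚ.+ By ℚ.* δ
        ≡⟨ Kδ≡ε ⟩
      ε ∎
      where
      open ℚ.≤-Reasoning
      ≥Nx : ∀ {k} → L ℕ.≤ k → Nx ℕ.≤ k
      ≥Nx h = ℕ.m⊔n≤o⇒m≤o Nx Ny (ℕ.m⊔n≤o⇒m≤o (Nx ℕ.⊔ Ny) (Mx ℕ.⊔ My) h)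
      ≥Ny : ∀ {k} → L ℕ.≤ k → Ny ℕ.≤ k
      ≥Ny h = ℕ.m⊔n≤o⇒n≤o Nx Ny (ℕ.m⊔n≤o⇒m≤o (Nx ℕ.⊔ Ny) (Mx ℕ.⊔ My) h)
      ≥Mx : ∀ {k} → L ℕ.≤ k → Mx ℕ.≤ k
      ≥Mx h = ℕ.m⊔n≤o⇒m≤o Mx My (ℕ.m⊔n≤o⇒n≤o (Nx ℕ.⊔ Ny) (Mx ℕ.⊔ My) h)
      ≥My : ∀ {k} → L ℕ.≤ k → My ℕ.≤ k
      ≥My h = ℕ.m⊔n≤o⇒n≤o Mx My (ℕ.m⊔n≤o⇒n≤o (Nx ℕ.⊔ Ny) (Mx ℕ.⊔ My) h)

open CauchyProperties

infixl 7 _*_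
infixl 6 _+_ _-_ _⊔_
infix  8 -_

fromℚ : ℚ → ℝ
fromℚ q = mkℝ (λ _ → q) (const-cauchy q)

fromℕ : ℕ → ℝ
fromℕ k = fromℚ (+ k ℚ./ 1)

0ℝ 1ℝ : ℝ
0ℝ = fromℚ 0ℚ
1ℝ = fromℚ 1ℚ

_+_ _*_ _⊔_ : ℝ → ℝ → ℝ
x + y = mkℝ (λ n → seq x n ℚ.+ seq y n) (+-cauchy {seq x} {seq y} (cauchy x) (cauchy y))
x * y = mkℝ (λ n → seq x n ℚ.* seq y n) (*-cauchy {seq x} {seq y} (cauchy x) (cauchy y))
x ⊔ y = mkℝ (λ n → seq x n ℚ.⊔ seq y n) (⊔-cauchy {seq x} {seq y} (cauchy x) (cauchy y))

-_ : ℝ → ℝ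
- x = mkℝ (λ n → ℚ.- seq x n) (neg-cauchy {seq x} (cauchy x))

_-_ : ℝ → ℝ → ℝ
x - y = x + (- y)

------------------------------------------------------------------------
-- Set functions on the subsets of an n-element set

-- The maximum over an empty index set is 0; it is only used multiplied by
-- the size of the index set.
max : List ℝ → ℝ
max []       = 0ℝ
max (x ∷ xs) = foldr₁ _⊔_ (x List⁺.∷ xs)

maxOver : ∀ {n} → Subset n → (Fin n → ℝ) → ℝ
maxOver {n} A g = max (map g (filter (_∈? A) (allFin n)))

SetFunction : ℕ → Set
SetFunction n = Subset n → ℝ

NonNegative : ∀ {n} → SetFunction n → Set
NonNegative f = ∀ S → 0ℝ ≤ f S

NonIncreasing : ∀ {n} → SetFunction n → Set
NonIncreasing f = ∀ S T → f (S ∪ T) ≤ f S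

Supermodular : ∀ {n} → SetFunction n → Set
Supermodular f = ∀ S T → f S + f T ≤ f (S ∩ T) + f (S ∪ T)

WeaklySupermodular : ∀ {n} → ℝ → SetFunction n → Set
WeaklySupermodular α f =
  1ℝ ≤ α × NonNegative f × NonIncreasing f ×
  (∀ S T → f S - f (S ∪ T)
    ≤ α * fromℕ ∣ T ─ S ∣ * maxOver (T ─ S) (λ i → f S - f (S ∪ ⁅ i ⁆)))

{-# OPTIONS --safe #-}
module Submission where

-- Adding the elements i of T ─ S to S one at a time, supermodularity bounds
-- each decrease of f by f S - f (S ∪ ⁅ i ⁆), because the returns diminish.
-- There are ∣ T ─ S ∣ steps and each is at most the maximum.

open import Defs
open import Data.Fin.Base using (Fin; zero; suc)
open import Data.Fin.Subset
  using (Subset; inside; outside; _∈_; ⁅_⁆; _∪_; _∩_; _─_; ∣_∣; ⋃)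
import Data.Fin.Subset.Properties as Sub
open import Data.Integer.Base as ℤ using (+_)
import Data.Integer.Properties as ℤ
open import Data.List.Base using (List; []; _∷_; map; filter; allFin; length; tabulate)
open import Data.List.Membership.Propositional using () renaming (_∈_ to _∈ˡ_)
open import Data.List.Membership.Propositional.Properties
  using (∈-map⁺; ∈-filter⁺; ∈-filter⁻; ∈-allFin)
import Data.List.Properties as List
open import Data.List.Relation.Unary.All as All using (All; []; _∷_)
open import Data.List.Relation.Unary.Any using (here; there)
open import Data.Nat.Base as ℕ using (ℕ)
import Data.Nat.Properties as ℕ
open import Data.Product.Base using (_,_; proj₂)
open import Data.Rational.Base as ℚ using (ℚ; 0ℚ; 1ℚ; ½)
import Data.Rational.Properties as ℚ
import Data.Rational.Solver as ℚSolver
import Data.Rational.Unnormalised.Base as ℚᵘ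
import Data.Rational.Unnormalised.Properties as ℚᵘ
open import Data.Sum.Base using (inj₁; inj₂)
open import Data.Vec.Base using ([]; _∷_)
open import Function.Base using (_∘_)
open import Relation.Binary.PropositionalEquality
open import Relation.Nullary using (yes; no; contradiction)

open ℚSolver.+-*-Solver using (solve; con; _:+_; _:*_; _:-_; _:=_)
open CauchyProperties using (half-pos; half+half)

pointwise-≤ : ∀ {x y} → (∀ n → seq x n ℚ.≤ seq y n) → x ≤ y
pointwise-≤ {x} {y} h ε 0<ε = 0 , λ n _ → begin
  seq x n          ≤⟨ h n ⟩
  seq y n          ≡⟨ ℚ.+-identityʳ (seq y n) ⟨
  seq y n ℚ.+ 0ℚ   ≤⟨ ℚ.+-monoʳ-≤ (seq y n) (ℚ.<⇒≤ 0<ε) ⟩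
  seq y n ℚ.+ ε    ∎
  where open ℚ.≤-Reasoning

≤-refl : ∀ {x} → x ≤ x
≤-refl {x} = pointwise-≤ {x} {x} λ _ → ℚ.≤-refl

+-mono-≤ : ∀ {x y z w} → x ≤ y → z ≤ w → x + z ≤ y + w
+-mono-≤ {x} {y} {z} {w} x≤y z≤w ε 0<ε
  with x≤y (ε ℚ.* ½) (half-pos 0<ε) | z≤w (ε ℚ.* ½) (half-pos 0<ε)
... | M , h | N , k = M ℕ.⊔ N , λ n n≥ → begin
  seq x n ℚ.+ seq z n
    ≤⟨ ℚ.+-mono-≤ (h n (ℕ.m⊔n≤o⇒m≤o M N n≥)) (k n (ℕ.m⊔n≤o⇒n≤o M N n≥)) ⟩
  (seq y n ℚ.+ ε ℚ.* ½) ℚ.+ (seq w n ℚ.+ ε ℚ.* ½)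
    ≡⟨ solve 3 (λ y w e → (y :+ e) :+ (w :+ e) := (y :+ w) :+ (e :+ e))
         refl (seq y n) (seq w n) (ε ℚ.* ½) ⟩
  (seq y n ℚ.+ seq w n) ℚ.+ (ε ℚ.* ½ ℚ.+ ε ℚ.* ½)
    ≡⟨ cong ((seq y n ℚ.+ seq w n) ℚ.+_) (half+half ε) ⟩
  (seq y n ℚ.+ seq w n) ℚ.+ ε ∎
  where open ℚ.≤-Reasoning

-- Rearrangements and cancellations in inequalities between reals are
-- instances of this, since x ≤ y depends only on the sequence y - x.
≤-resp-difference : ∀ {x y x′ y′} →
  (∀ n → seq y n ℚ.- seq x n ≡ seq y′ n ℚ.- seq x′ n) → x ≤ y → x′ ≤ y′
≤-resp-difference {x} {y} {x′} {y′} eq x≤y ε 0<ε with x≤y ε 0<ε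
... | N , h = N , λ n n≥ → begin
  seq x′ n
    ≡⟨ solve 2 (λ x x′ → x′ := x :+ (x′ :- x)) refl (seq x n) (seq x′ n) ⟩
  seq x n ℚ.+ (seq x′ n ℚ.- seq x n)
    ≤⟨ ℚ.+-monoˡ-≤ (seq x′ n ℚ.- seq x n) (h n n≥) ⟩
  (seq y n ℚ.+ ε) ℚ.+ (seq x′ n ℚ.- seq x n)
    ≡⟨ solve 4 (λ x y x′ e → (y :+ e) :+ (x′ :- x) := ((y :- x) :+ x′) :+ e)
         refl (seq x n) (seq y n) (seq x′ n) ε ⟩
  ((seq y n ℚ.- seq x n) ℚ.+ seq x′ n) ℚ.+ ε
    ≡⟨ cong (λ d → (d ℚ.+ seq x′ n) ℚ.+ ε) (eq n) ⟩
  ((seq y′ n ℚ.- seq x′ n) ℚ.+ seq x′ n) ℚ.+ ε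
    ≡⟨ solve 3 (λ x′ y′ e → ((y′ :- x′) :+ x′) :+ e := y′ :+ e)
         refl (seq x′ n) (seq y′ n) ε ⟩
  seq y′ n ℚ.+ ε ∎
  where open ℚ.≤-Reasoning

-- The maximum is taken termwise on the sequences, so each entry lies below it at every index, with
-- no ε. Membership makes the list nonempty, so the default value of `max` never enters.
∈⇒≤max : ∀ {x xs} → x ∈ˡ xs → ∀ n → seq x n ℚ.≤ seq (max xs) n
∈⇒≤max {x} {_ ∷ []}     (here refl) n = ℚ.≤-refl
∈⇒≤max {x} {_ ∷ y ∷ ys} (here refl) n = ℚ.p≤p⊔q (seq x n) (seq (max (y ∷ ys)) n)
∈⇒≤max {x} {z ∷ y ∷ ys} (there x∈)  n =
  ℚ.≤-trans (∈⇒≤max x∈ n) (ℚ.p≤q⊔p (seq z n) (seq (max (y ∷ ys)) n))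

-- Needed when the count of steps grows by one. `ℚ._/_` divides by a gcd that does not reduce for a
-- variable `k`, hence the passage to unnormalised rationals, where numerators over 1 simply add.
suc/1 : ∀ k → + ℕ.suc k ℚ./ 1 ≡ 1ℚ ℚ.+ + k ℚ./ 1
suc/1 k = ℚ.toℚᵘ-injective (begin
  ℚ.toℚᵘ (+ ℕ.suc k ℚ./ 1)            ≈⟨ ℚ.toℚᵘ-fromℚᵘ (ℚᵘ.mkℚᵘ (+ ℕ.suc k) 0) ⟩
  ℚᵘ.mkℚᵘ (+ ℕ.suc k) 0               ≈⟨ ℚᵘ.*≡* 
                                           (cong (λ j → (+ 1 ℤ.+ j) ℤ.* + 1) (sym (ℤ.*-identityʳ (+ k)))) ⟩
  ℚᵘ.1ℚᵘ ℚᵘ.+ ℚᵘ.mkℚᵘ (+ k) 0         ≈⟨ ℚᵘ.+-congʳ ℚᵘ.1ℚᵘ (ℚ.toℚᵘ-fromℚᵘ (ℚᵘ.mkℚᵘ (+ k) 0)) ⟨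
  ℚᵘ.1ℚᵘ ℚᵘ.+ ℚ.toℚᵘ (+ k ℚ./ 1)      ≈⟨ ℚ.toℚᵘ-homo-+ 1ℚ (+ k ℚ./ 1) ⟨
  ℚ.toℚᵘ (1ℚ ℚ.+ + k ℚ./ 1)           ∎)
  where open ℚᵘ.≃-Reasoning

length-filter-∈?-map-suc : ∀ {n} s (p : Subset n) xs →
  length (filter (Sub._∈? (s ∷ p)) (map suc xs)) ≡ length (filter (Sub._∈? p) xs)
length-filter-∈?-map-suc s p []       = refl
length-filter-∈?-map-suc s p (x ∷ xs) with x Sub.∈? p
... | yes _ = cong ℕ.suc (length-filter-∈?-map-suc s p xs)
... | no  _ = length-filter-∈?-map-suc s p xs

-- By definition the list over which `maxOver p` takes its maximum.
elements : ∀ {n} → Subset n → List (Fin n)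
elements {n} p = filter (Sub._∈? p) (allFin n)

length-elements : ∀ {n} (p : Subset n) → length (elements p) ≡ ∣ p ∣
length-elements []                = refl
length-elements {ℕ.suc n} (s ∷ p) = helper s
  where
  tail : ∀ s → length (filter (Sub._∈? (s ∷ p)) (tabulate suc)) ≡ ∣ p ∣
  tail s = trans
    -- The tail of `allFin (suc n)` is `tabulate suc`; written as `map suc (allFin n)` it reduces to
    -- the induction hypothesis.
    (cong (length ∘ filter (Sub._∈? (s ∷ p))) (sym (List.map-tabulate {n = n} (λ i → i) suc)))
    (trans (length-filter-∈?-map-suc s p (allFin n)) (length-elements p))

  -- Only once `s` is split does the membership test on `zero` compute.
  helper : ∀ s → length (elements (s ∷ p)) ≡ ∣ s ∷ p ∣
  helper inside  = cong ℕ.suc (tail inside)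
  helper outside = tail outside

∈-⋃-singletons⁺ : ∀ {n} {i : Fin n} {is} → i ∈ˡ is → i ∈ ⋃ (map ⁅_⁆ is)
∈-⋃-singletons⁺ {i = i} (here refl) = Sub.x∈p∪q⁺ (inj₁ (Sub.x∈⁅x⁆ i))
∈-⋃-singletons⁺         (there i∈)  = Sub.x∈p∪q⁺ (inj₂ (∈-⋃-singletons⁺ i∈))

∈-⋃-singletons⁻ : ∀ {n} {i : Fin n} is → i ∈ ⋃ (map ⁅_⁆ is) → i ∈ˡ is
∈-⋃-singletons⁻ []       i∈ = contradiction i∈ Sub.∉⊥
∈-⋃-singletons⁻ (j ∷ is) i∈ with Sub.x∈p∪q⁻ ⁅ j ⁆ (⋃ (map ⁅_⁆ is)) i∈
... | inj₁ i∈⁅j⁆ = here (Sub.x∈⁅y⁆⇒x≡y j i∈⁅j⁆)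
... | inj₂ i∈⋃   = there (∈-⋃-singletons⁻ is i∈⋃)

⋃-elements : ∀ {n} (p : Subset n) → ⋃ (map ⁅_⁆ (elements p)) ≡ p
⋃-elements {n} p = Sub.⊆-antisym
  (λ i∈ → proj₂ (∈-filter⁻ (Sub._∈? p) {xs = allFin n} (∈-⋃-singletons⁻ (elements p) i∈)))
  (λ i∈p → ∈-⋃-singletons⁺ (∈-filter⁺ (Sub._∈? p) (∈-allFin _) i∈p))

p∪[q─p]≡p∪q : ∀ {n} (p q : Subset n) → p ∪ (q ─ p) ≡ p ∪ q
p∪[q─p]≡p∪q []            []      = refl
p∪[q─p]≡p∪q (inside  ∷ p) (_ ∷ q) = cong (inside ∷_) (p∪[q─p]≡p∪q p q)
p∪[q─p]≡p∪q (outside ∷ p) (s ∷ q) = cong (s ∷_) (p∪[q─p]≡p∪q p q)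

module _ {n} (f : SetFunction n) (nonIncreasing : NonIncreasing f)
         (supermodular : Supermodular f) where

  -- The sets S ∪ P and S ∪ Q meet in S ∪ (P ∩ Q), where f is at most f S;
  -- P and Q need not be disjoint.
  supermodular-above : ∀ S P Q → f (S ∪ P) + f (S ∪ Q) ≤ f S + f (S ∪ (P ∪ Q))
  supermodular-above S P Q = ≤-resp-difference
    {(f (S ∪ P) + f (S ∪ Q)) + f (S ∪ (P ∩ Q))}
    {(f (S ∪ (P ∩ Q)) + f (S ∪ (P ∪ Q))) + f S}
    {f (S ∪ P) + f (S ∪ Q)} {f S + f (S ∪ (P ∪ Q))}
    (λ k → solve 5 (λ p q i u s → ((i :+ u) :+ s) :- ((p :+ q) :+ i) := (s :+ u) :- (p :+ q))
       refl (seq (f (S ∪ P)) k) (seq (f (S ∪ Q)) k)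
       (seq (f (S ∪ (P ∩ Q))) k) (seq (f (S ∪ (P ∪ Q))) k) (seq (f S) k))
    (+-mono-≤ {f (S ∪ P) + f (S ∪ Q)} {f (S ∪ (P ∩ Q)) + f (S ∪ (P ∪ Q))}
      {f (S ∪ (P ∩ Q))} {f S}
      (subst₂ (λ I U → f (S ∪ P) + f (S ∪ Q) ≤ f I + f U)
        (sym (Sub.∪-distribˡ-∩ S P Q)) union (supermodular (S ∪ P) (S ∪ Q)))
      (nonIncreasing S (P ∩ Q)))
    where
    union : (S ∪ P) ∪ (S ∪ Q) ≡ S ∪ (P ∪ Q)
    union = begin
      (S ∪ P) ∪ (S ∪ Q)   ≡⟨ Sub.∪-assoc S P (S ∪ Q) ⟩
      S ∪ (P ∪ (S ∪ Q))   ≡⟨ cong (S ∪_) (Sub.∪-assoc P S Q) ⟨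
      S ∪ ((P ∪ S) ∪ Q)   ≡⟨ cong (λ R → S ∪ (R ∪ Q)) (Sub.∪-comm P S) ⟩
      S ∪ ((S ∪ P) ∪ Q)   ≡⟨ cong (S ∪_) (Sub.∪-assoc S P Q) ⟩
      S ∪ (S ∪ (P ∪ Q))   ≡⟨ Sub.∪-assoc S S (P ∪ Q) ⟨
      (S ∪ S) ∪ (P ∪ Q)   ≡⟨ cong (_∪ (P ∪ Q)) (Sub.∪-idem S) ⟩
      S ∪ (P ∪ Q)         ∎
      where open ≡-Reasoning

  -- Induction on `is` with `S` fixed: `supermodular-above` makes the decrease `f S - f (S ∪ P)`
  -- subadditive in `P`, so every marginal decrease is measured from the original `S`.
  decrease-⋃-singletons : ∀ S M is → All (λ i → f S - f (S ∪ ⁅ i ⁆) ≤ M) is →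
    f S - f (S ∪ ⋃ (map ⁅_⁆ is)) ≤ fromℕ (length is) * M
  decrease-⋃-singletons S M [] [] = subst (λ R → f S - f R ≤ fromℕ 0 * M)
    (sym (Sub.∪-identityʳ S))
    (≤-resp-difference {0ℝ} {0ℝ} {f S - f S} {fromℕ 0 * M}
      (λ k → solve 2 (λ s m → con 0ℚ :- con 0ℚ := con 0ℚ :* m :- (s :- s))
        refl (seq (f S) k) (seq M k))
      (≤-refl {0ℝ}))
  -- The bound for `i`, the induction hypothesis and `supermodular-above` are added up; `f A`, `f B`
  -- and the surplus `f S` then cancel.
  decrease-⋃-singletons S M (i ∷ is) (h ∷ hs) = ≤-resp-difference
    {((f S - f A) + (f S - f B)) + (f A + f B)} {(M + fromℕ (length is) * M) + (f S + f C)}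
    {f S - f C} {fromℕ (length (i ∷ is)) * M}
    (λ k → trans
      (solve 6 (λ s a b c m l →
          ((m :+ l :* m) :+ (s :+ c)) :- (((s :- a) :+ (s :- b)) :+ (a :+ b))
            := (con 1ℚ :+ l) :* m :- (s :- c))
        refl (seq (f S) k) (seq (f A) k) (seq (f B) k) (seq (f C) k) (seq M k)
        (+ length is ℚ./ 1))
      (cong (λ l → l ℚ.* seq M k ℚ.- (seq (f S) k ℚ.- seq (f C) k)) (sym (suc/1 (length is)))))
    (+-mono-≤ {(f S - f A) + (f S - f B)} {M + fromℕ (length is) * M}
      {f A + f B} {f S + f C}
      (+-mono-≤ {f S - f A} {M} {f S - f B} {fromℕ (length is) * M}
        h (decrease-⋃-singletons S M is hs))
      (supermodular-above S ⁅ i ⁆ (⋃ (map ⁅_⁆ is))))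
    where
    A = S ∪ ⁅ i ⁆
    B = S ∪ ⋃ (map ⁅_⁆ is)
    C = S ∪ (⁅ i ⁆ ∪ ⋃ (map ⁅_⁆ is))

  decrease≤∣T─S∣*max : ∀ S T →
    f S - f (S ∪ T) ≤ fromℕ ∣ T ─ S ∣ * maxOver (T ─ S) (λ i → f S - f (S ∪ ⁅ i ⁆))
  decrease≤∣T─S∣*max S T = subst₂ (λ R k → f S - f R ≤ fromℕ k * M)
    -- The singletons of `T ─ S` unite with `S` to `S ∪ T`, and their number is `∣ T ─ S ∣`.
    (trans (cong (S ∪_) (⋃-elements (T ─ S))) (p∪[q─p]≡p∪q S T))
    (length-elements (T ─ S))
    -- Each marginal decrease is an entry of the list whose maximum is `M`. If `T ─ S` is empty, the
    -- default `M = 0` is multiplied by the length 0.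
    (decrease-⋃-singletons S M (elements (T ─ S)) (All.tabulate λ {i} i∈ →
      pointwise-≤ {f S - f (S ∪ ⁅ i ⁆)} {M} (∈⇒≤max (∈-map⁺ (λ i → f S - f (S ∪ ⁅ i ⁆)) i∈))))
    where M = maxOver (T ─ S) (λ i → f S - f (S ∪ ⁅ i ⁆))

lemma1 : ∀ (n : ℕ) (f : SetFunction n) →
    NonNegative f → NonIncreasing f → Supermodular f → WeaklySupermodular 1ℝ f
lemma1 n f nonNegative nonIncreasing supermodular =
  ≤-refl {1ℝ} , nonNegative , nonIncreasing , λ S T →
    -- The factor `1ℝ` is multiplied into the sequence termwise, and is removed there by the
    -- identity law of ℚ.
    ≤-resp-difference
      {f S - f (S ∪ T)} {fromℕ ∣ T ─ S ∣ * M S T}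
      {f S - f (S ∪ T)} {1ℝ * fromℕ ∣ T ─ S ∣ * M S T}
      (λ k → cong (λ l → l ℚ.* seq (M S T) k ℚ.- (seq (f S) k ℚ.- seq (f (S ∪ T)) k))
        (sym (ℚ.*-identityˡ (+ ∣ T ─ S ∣ ℚ./ 1))))
      (decrease≤∣T─S∣*max f nonIncreasing supermodular S T)
  where
  M : Subset n → Subset n → ℝ
  M S T = maxOver (T ─ S) (λ i → f S - f (S ∪ ⁅ i ⁆))
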